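{- Let $X$ be an $X$-set parameter, let $G$ and $G'$ be graphs with no isolated vertices, and suppose $\varphi:\mathscr{X}^{\rm TAR}(G)\to\mathscr{X}^{\rm TAR}(G')$ is a graph isomorphism. Then $|\varphi(S)|=|S|$ for every $X$-set $S$ of $G$ if and only if there exists a bijection $\psi:V(G)\to V(G')$ such that $\psi(S)=\varphi(S)$ for every $X$-set $S$ of $G$ (where $\psi(S)=\{\psi(s):s\in S\}$).
   Context: All graphs are simple, finite, with nonempty vertex set. An $X$-set parameter is a graph parameter $X(G)$ defined as the minimum cardinality of an $X$-set of $G$, where the $X$-sets of each graph are subsets of its vertex set determined by some property satisfying: (1) supersets (within $V(G)$) of $X$-sets are $X$-sets; (2) the empty set is never an $X$-set; (3) an $X$-set of a disconnected graph is the union of an $X$-set of each component; (4) if $G$ has no isolated vertices, every set of $|V(G)|-1$ vertices is an $X$-set. The $X$-TAR graph $\mathscr{X}^{\rm TAR}(G)$ has as vertices all $X$-sets of $G$, with $S_1,S_2$ adjacent iff $|S_1\ominus S_2|=1$ (symmetric difference). -}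

module Defs where

open import Data.Bool.Base using (true)
open import Data.Fin.Base using (Fin; zero; suc)
open import Data.Fin.Properties using (any?) renaming (_≟_ to _≟ᶠ_)
open import Data.Fin.Subset
  using (Subset; inside; outside; _∈_; _⊆_; _∪_; _─_; ∣_∣; ⊥; Nonempty)
open import Data.Fin.Subset.Properties using (_∈?_; ∪-comm)
open import Data.Nat.Base using (ℕ; NonZero; _≤_; _∸_)
open import Data.Product.Base using (Σ; ∃; _×_; _,_)
open import Data.Refinement.Base using (Refinement-syntax; value)
open import Data.Vec.Base using ([]; _∷_; tabulate; there)
open import Data.Vec.Properties using (lookup∘tabulate; []=⇒lookup; lookup⇒[]=)
open import Function.Base using (_∘_)
open import Function.Bundles using (_⇔_; mk⇔; module Equivalence)
open import Function.Definitions using (Bijective)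
open import Level using (0ℓ)
open import Relation.Binary.Construct.Closure.ReflexiveTransitive using (Star; ε)
open import Relation.Binary.Core using (Rel)
open import Relation.Binary.Definitions using (Symmetric; Irreflexive; Decidable)
open import Relation.Binary.PropositionalEquality
  using (_≡_; refl; sym; trans; cong)
open import Relation.Nullary.Decidable
  using (Dec; yes; no; does; _×-dec_; dec-true)
open import Relation.Nullary.Negation using (¬_)

------------------------------------------------------------------------
-- Graphs

record SimpleGraph : Set₁ where
  field
    Vertex : Set
    _∼_    : Rel Vertex 0ℓ
    symm   : Symmetric _∼_
    irrefl : Irreflexive _≡_ _∼_

record IsIsomorphism (G H : SimpleGraph)
                     (f : SimpleGraph.Vertex G → SimpleGraph.Vertex H) : Set where
  private
    module G = SimpleGraph G
    module H = SimpleGraph H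
  field
    bijective : Bijective _≡_ _≡_ f
    adjacency : ∀ u v → u G.∼ v ⇔ f u H.∼ f v

-- Finite simple graphs with nonempty vertex set.  Adjacency is decidable so
-- that, as for any finite graph in the usual sense, questions such as
-- connectedness have definite answers.
record Graph : Set₁ where
  field
    order       : ℕ
    .{{nonZero}} : NonZero order
    _∼_         : Rel (Fin order) 0ℓ
    symm        : Symmetric _∼_
    irrefl      : Irreflexive _≡_ _∼_
    _∼?_        : Decidable _∼_

  V : Set
  V = Fin order

  simple : SimpleGraph
  simple = record { Vertex = V ; _∼_ = _∼_ ; symm = symm ; irrefl = irrefl }

  NoIsolatedVertices : Set
  NoIsolatedVertices = ∀ v → ∃ λ w → v ∼ w

  Connected : Set
  Connected = ∀ u v → Star _∼_ u v

  Disconnected : Set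
  Disconnected = ¬ Connected

  IsComponent : Subset order → Set
  IsComponent C = ∃ λ v → ∀ w → w ∈ C ⇔ Star _∼_ v w

open Graph using (order; V; simple; NoIsolatedVertices; Disconnected; IsComponent)

------------------------------------------------------------------------
-- Subsets

private
  variable
    m n : ℕ

image : (Fin m → Fin n) → Subset m → Subset n
image f S = tabulate λ w → does (any? λ s → (s ∈? S) ×-dec (f s ≟ᶠ w))

∈-image : (f : Fin m → Fin n) (S : Subset m) (w : Fin n) →
          w ∈ image f S ⇔ (∃ λ s → s ∈ S × f s ≡ w)
∈-image f S w = mk⇔ to from
  where
  P? : ∀ w → Dec (∃ λ s → s ∈ S × f s ≡ w)
  P? w = any? λ s → (s ∈? S) ×-dec (f s ≟ᶠ w)

  witness : ∀ {A : Set} (A? : Dec A) → does A? ≡ true → A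
  witness (yes a) _ = a
  witness (no _)  ()

  to : w ∈ image f S → ∃ λ s → s ∈ S × f s ≡ w
  to w∈ = witness (P? w)
    (trans (sym (lookup∘tabulate (does ∘ P?) w)) ([]=⇒lookup w∈))

  from : (∃ λ s → s ∈ S × f s ≡ w) → w ∈ image f S
  from p = lookup⇒[]= w _
    (trans (lookup∘tabulate (does ∘ P?) w) (dec-true (P? w) p))

infixl 5 _⊖_
_⊖_ : Subset n → Subset n → Subset n
S ⊖ T = (S ─ T) ∪ (T ─ S)

∣S⊖S∣≡0 : (S : Subset n) → ∣ S ⊖ S ∣ ≡ 0
∣S⊖S∣≡0 []            = refl
∣S⊖S∣≡0 (inside  ∷ S) = ∣S⊖S∣≡0 S
∣S⊖S∣≡0 (outside ∷ S) = ∣S⊖S∣≡0 S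

-- The increasing enumeration of the elements of C.
embed : (C : Subset n) → Fin ∣ C ∣ → Fin n
embed (outside ∷ C) i       = suc (embed C i)
embed (inside  ∷ C) zero    = zero
embed (inside  ∷ C) (suc i) = suc (embed C i)

∣C∣-nonZero : (C : Subset n) → Nonempty C → NonZero ∣ C ∣
∣C∣-nonZero (inside  ∷ C) _                   = _
∣C∣-nonZero (outside ∷ C) (suc v , there v∈C) = ∣C∣-nonZero C (v , v∈C)

------------------------------------------------------------------------
-- Induced subgraphs

-- The vertex i of the induced subgraph stands for the vertex embed C i of G.
induced : (G : Graph) (C : Subset (order G)) → Nonempty C → Graph
induced G C C≢∅ = record
  { order   = ∣ C ∣
  ; nonZero = ∣C∣-nonZero C C≢∅
  ; _∼_     = λ i j → embed C i G.∼ embed C j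
  ; symm    = G.symm
  ; irrefl  = λ i≡j → G.irrefl (cong (embed C) i≡j)
  ; _∼?_    = λ i j → embed C i G.∼? embed C j
  }
  where module G = Graph G

component-nonempty : (G : Graph) {C : Subset (order G)} →
                     IsComponent G C → Nonempty C
component-nonempty G (v , C≡[v]) = v , Equivalence.from (C≡[v] v) ε

component : (G : Graph) (C : Subset (order G)) → IsComponent G C → Graph
component G C c = induced G C (component-nonempty G c)

------------------------------------------------------------------------
-- X-set parameters

record XSetParameter : Set₁ where
  field
    IsXSet : (G : Graph) → Subset (order G) → Set

    -- Being an X-set is a graph-theoretic property: it does not depend on
    -- how the vertices are numbered.
    invariant : ∀ {G H} (f : V G → V H) → IsIsomorphism (simple G) (simple H) f →
                ∀ S → IsXSet G S → IsXSet H (image f S)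

    superset : ∀ G {S S′} → S ⊆ S′ → IsXSet G S → IsXSet G S′

    empty : ∀ G → ¬ IsXSet G ⊥

    -- T assigns to each component C a subset of its vertices, and S is the
    -- union of these; the values of T at other subsets play no role.
    union : ∀ G → Disconnected G → ∀ S →
            IsXSet G S ⇔
            (Σ ((C : Subset (order G)) → Subset ∣ C ∣) λ T →
              (∀ C (c : IsComponent G C) → IsXSet (component G C c) (T C)) ×
              (∀ v → v ∈ S ⇔
                     (∃ λ C → IsComponent G C × v ∈ image (embed C) (T C))))

    allButOne : ∀ G → NoIsolatedVertices G →
                ∀ S → ∣ S ∣ ≡ order G ∸ 1 → IsXSet G S

    -- The parameter X(G) itself, the minimum cardinality of an X-set.
    parameter : Graph → ℕ
    attained  : ∀ G → ∃ λ S → IsXSet G S × ∣ S ∣ ≡ parameter G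
    minimum   : ∀ G S → IsXSet G S → parameter G ≤ ∣ S ∣

------------------------------------------------------------------------
-- The X-TAR graph

module _ (X : XSetParameter) where

  open XSetParameter X

  -- A refinement type, so that two X-sets are equal as soon as they are
  -- equal as sets of vertices.
  XSet : Graph → Set
  XSet G = [ S ∈ Subset (order G) ∣ IsXSet G S ]

  TAR : Graph → SimpleGraph
  TAR G = record
    { Vertex = XSet G
    ; _∼_    = λ S₁ S₂ → ∣ value S₁ ⊖ value S₂ ∣ ≡ 1
    ; symm   = λ {S₁} {S₂} e →
        trans (cong ∣_∣ (∪-comm (value S₂ ─ value S₁) (value S₁ ─ value S₂))) e
    ; irrefl = λ { {S} refl e → 0≢1 (trans (sym (∣S⊖S∣≡0 (value S))) e) }
    }
    where
    0≢1 : ¬ (0 ≡ 1)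
    0≢1 ()

-- Coatoms of the lattice of vertex sets are X-sets, and a cardinality-preserving
-- isomorphism φ matches them, φ (V(G) ∖ v) = V(G′) ∖ ψ v, which defines ψ.  Adding
-- a vertex to an X-set is an edge of the TAR graph, so φ is also monotone.  Hence
-- v ∉ S, i.e. S ⊆ V(G) ∖ v, gives ψ v ∉ φ S; so φ S ⊆ ψ S, and both have size ∣ S ∣.
module Submission where

open import Defs
open import Data.Fin.Base using (Fin; zero; suc)
open import Data.Fin.Properties using (any?)
open import Data.Fin.Subset
  using (Subset; inside; outside; _∈_; _∉_; _⊆_; _⊃_; _∪_; ∁; ⁅_⁆; ⊤; ⊥; ∣_∣)
open import Data.Fin.Subset.Induction using (⊃-wellFounded)
open import Data.Fin.Subset.Properties
open import Data.Irrelevant using ([_])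
open import Data.Nat.Base using (ℕ; suc; _≤_; _<_; _∸_; s≤s)
open import Data.Nat.Properties
  using (≤-refl; ≤-reflexive; ≤-trans; ≤-antisym; <⇒≱; suc-injective; n≤1+n;
         module ≤-Reasoning)
open import Data.Product.Base using (∃; _×_; _,_; proj₁; proj₂)
open import Data.Refinement.Base using (value; _,_)
open import Data.Refinement.Properties using (value-injective)
open import Data.Sum.Base using (_⊎_; inj₁; inj₂)
import Data.Sum.Base as Sum
open import Data.Vec.Base using ([]; _∷_; here; there)
open import Function.Base using (_∘_)
open import Function.Bundles using (_⇔_; mk⇔; module Equivalence)
open import Function.Consequences.Propositional
  using (strictlySurjective⇒surjective; surjective⇒strictlySurjective)
open import Function.Definitions
  using (Bijective; Injective; StrictlySurjective)
open import Induction.WellFounded using (Acc; acc)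
open import Relation.Binary.PropositionalEquality
open import Relation.Nullary.Decidable using (yes; no; _×-dec_; ¬?; decidable-stable)
open import Relation.Nullary.Negation using (contradiction)

private
  variable
    m n : ℕ

-- Cardinalities and coatoms in the lattice of subsets

p⊆q∧∣q∣≤∣p∣⇒p≡q : {p q : Subset n} → p ⊆ q → ∣ q ∣ ≤ ∣ p ∣ → p ≡ q
p⊆q∧∣q∣≤∣p∣⇒p≡q {p = p} p⊆q ∣q∣≤∣p∣ = ⊆-antisym p⊆q λ {x} x∈q →
  decidable-stable (x ∈? p) λ x∉p →
    <⇒≱ (p⊂q⇒∣p∣<∣q∣ (p⊆q , x , x∈q , x∉p)) ∣q∣≤∣p∣

∣p∣<n⇒∃∉ : (p : Subset n) → ∣ p ∣ < n → ∃ λ x → x ∉ p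
∣p∣<n⇒∃∉ {n} p ∣p∣<n with any? (λ x → ¬? (x ∈? p))
... | yes x∉p = x∉p
... | no ¬∃∉  = contradiction n≤∣p∣ (<⇒≱ ∣p∣<n)
  where
  n≤∣p∣ : n ≤ ∣ p ∣
  n≤∣p∣ = subst (_≤ ∣ p ∣) (∣⊤∣≡n n)
    (p⊆q⇒∣p∣≤∣q∣ {p = ⊤} λ {x} _ → decidable-stable (x ∈? p) λ x∉p → ¬∃∉ (x , x∉p))

∣∁⁅x⁆∣≡n∸1 : (x : Fin n) → ∣ ∁ ⁅ x ⁆ ∣ ≡ n ∸ 1
∣∁⁅x⁆∣≡n∸1 {n} x = trans (∣∁p∣≡n∸∣p∣ ⁅ x ⁆) (cong (n ∸_) (∣⁅x⁆∣≡1 x))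

x∉∁⁅x⁆ : (x : Fin n) → x ∉ ∁ ⁅ x ⁆
x∉∁⁅x⁆ x = x∈p⇒x∉∁p (x∈⁅x⁆ x)

x∉p⇒p⊆∁⁅x⁆ : {p : Subset n} {x : Fin n} → x ∉ p → p ⊆ ∁ ⁅ x ⁆
x∉p⇒p⊆∁⁅x⁆ {p = p} x∉p y∈p =
  x∉p⇒x∈∁p λ y∈⁅x⁆ → x∉p (subst (_∈ p) (x∈⁅y⁆⇒x≡y _ y∈⁅x⁆) y∈p)

-- The argument in Fin n excludes n = 0, where n ∸ 1 = 0.
∣p∣≡n∸1⇒p≡∁⁅x⁆ : (p : Subset n) → Fin n → ∣ p ∣ ≡ n ∸ 1 → ∃ λ x → p ≡ ∁ ⁅ x ⁆
∣p∣≡n∸1⇒p≡∁⁅x⁆ {suc n} p _ ∣p∣≡n∸1 =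
  let x , x∉p = ∣p∣<n⇒∃∉ p (s≤s (≤-reflexive ∣p∣≡n∸1))
  in  x , p⊆q∧∣q∣≤∣p∣⇒p≡q (x∉p⇒p⊆∁⁅x⁆ x∉p)
            (≤-reflexive (trans (∣∁⁅x⁆∣≡n∸1 x) (sym ∣p∣≡n∸1)))

-- The vertex `x` is missing from the first coatom, hence from the second, which misses only `y`.
∁⁅⁆-injective : {x y : Fin n} → ∁ ⁅ x ⁆ ≡ ∁ ⁅ y ⁆ → x ≡ y
∁⁅⁆-injective {x = x} {y} eq =
  x∈⁅y⁆⇒x≡y y (x∉∁p⇒x∈p (subst (x ∉_) eq (x∉∁⁅x⁆ x)))

-- One-element changes of a set, and cardinalities of images

∣p∪⁅x⁆∣≤1+∣p∣ : (p : Subset n) (x : Fin n) → ∣ p ∪ ⁅ x ⁆ ∣ ≤ suc ∣ p ∣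
∣p∪⁅x⁆∣≤1+∣p∣ (inside  ∷ p) zero    rewrite ∪-identityʳ p = n≤1+n _
∣p∪⁅x⁆∣≤1+∣p∣ (outside ∷ p) zero    rewrite ∪-identityʳ p = ≤-refl
∣p∪⁅x⁆∣≤1+∣p∣ (inside  ∷ p) (suc x) = s≤s (∣p∪⁅x⁆∣≤1+∣p∣ p x)
∣p∪⁅x⁆∣≤1+∣p∣ (outside ∷ p) (suc x) = ∣p∪⁅x⁆∣≤1+∣p∣ p x

∣p⊖[p∪⁅x⁆]∣≡1 : {p : Subset n} {x : Fin n} → x ∉ p → ∣ p ⊖ (p ∪ ⁅ x ⁆) ∣ ≡ 1
∣p⊖[p∪⁅x⁆]∣≡1 {p = inside  ∷ p} {zero}  x∉p = contradiction here x∉p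
∣p⊖[p∪⁅x⁆]∣≡1 {p = outside ∷ p} {zero}  x∉p rewrite ∪-identityʳ p = cong suc (∣S⊖S∣≡0 p)
∣p⊖[p∪⁅x⁆]∣≡1 {p = inside  ∷ p} {suc x} x∉p = ∣p⊖[p∪⁅x⁆]∣≡1 (x∉p ∘ there)
∣p⊖[p∪⁅x⁆]∣≡1 {p = outside ∷ p} {suc x} x∉p = ∣p⊖[p∪⁅x⁆]∣≡1 (x∉p ∘ there)

∣p⊖q∣≡0⇒p≡q : (p q : Subset n) → ∣ p ⊖ q ∣ ≡ 0 → p ≡ q
∣p⊖q∣≡0⇒p≡q []            []            _  = refl
∣p⊖q∣≡0⇒p≡q (inside  ∷ p) (inside  ∷ q) eq = cong (inside ∷_) (∣p⊖q∣≡0⇒p≡q p q eq)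
∣p⊖q∣≡0⇒p≡q (outside ∷ p) (outside ∷ q) eq = cong (outside ∷_) (∣p⊖q∣≡0⇒p≡q p q eq)

-- Induction along the coordinates: the first one where the sets differ uses up the whole
-- difference, so the tails are equal and the set containing that element is the larger one.
∣p⊖q∣≡1⇒comparable : (p q : Subset n) → ∣ p ⊖ q ∣ ≡ 1 → p ⊆ q ⊎ q ⊆ p
∣p⊖q∣≡1⇒comparable []            []            ()
∣p⊖q∣≡1⇒comparable (inside  ∷ p) (inside  ∷ q) eq = Sum.map s⊆s s⊆s (∣p⊖q∣≡1⇒comparable p q eq)
∣p⊖q∣≡1⇒comparable (outside ∷ p) (outside ∷ q) eq = Sum.map s⊆s s⊆s (∣p⊖q∣≡1⇒comparable p q eq)
∣p⊖q∣≡1⇒comparable (inside  ∷ p) (outside ∷ q) eq =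
  inj₂ (out⊆ (⊆-reflexive (sym (∣p⊖q∣≡0⇒p≡q p q (suc-injective eq)))))
∣p⊖q∣≡1⇒comparable (outside ∷ p) (inside  ∷ q) eq =
  inj₁ (out⊆ (⊆-reflexive (∣p⊖q∣≡0⇒p≡q p q (suc-injective eq))))

-- Cardinality orients an edge of the TAR graph: if `q ⊆ p` instead, the bound on the sizes makes
-- the two sets equal.
∣p⊖q∣≡1∧∣p∣≤∣q∣⇒p⊆q : {p q : Subset n} → ∣ p ⊖ q ∣ ≡ 1 → ∣ p ∣ ≤ ∣ q ∣ → p ⊆ q
∣p⊖q∣≡1∧∣p∣≤∣q∣⇒p⊆q {p = p} {q} eq ∣p∣≤∣q∣ with ∣p⊖q∣≡1⇒comparable p q eq
... | inj₁ p⊆q = p⊆q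
... | inj₂ q⊆p = ⊆-reflexive (sym (p⊆q∧∣q∣≤∣p∣⇒p≡q q⊆p ∣p∣≤∣q∣))

-- Each element of `S` contributes at most one element to the image, so induction on `S` works for
-- an arbitrary map `f`.
∣image∣≤ : (f : Fin m → Fin n) (S : Subset m) → ∣ image f S ∣ ≤ ∣ S ∣
∣image∣≤ {n = n} f [] =
  ≤-trans (p⊆q⇒∣p∣≤∣q∣ {q = ⊥} λ {w} w∈ →
            contradiction (proj₁ (Equivalence.to (∈-image f [] w) w∈)) λ ())
          (≤-reflexive (∣⊥∣≡0 n))
∣image∣≤ f (outside ∷ S) = ≤-trans (p⊆q⇒∣p∣≤∣q∣ image⊆) (∣image∣≤ (f ∘ suc) S)
  where
  image⊆ : image f (outside ∷ S) ⊆ image (f ∘ suc) S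
  image⊆ {w} w∈ with suc s , there s∈S , eq ← Equivalence.to (∈-image f (outside ∷ S) w) w∈ =
    Equivalence.from (∈-image (f ∘ suc) S w) (s , s∈S , eq)
∣image∣≤ f (inside ∷ S) = begin
  ∣ image f (inside ∷ S) ∣            ≤⟨ p⊆q⇒∣p∣≤∣q∣ image⊆ ⟩
  ∣ image (f ∘ suc) S ∪ ⁅ f zero ⁆ ∣  ≤⟨ ∣p∪⁅x⁆∣≤1+∣p∣ (image (f ∘ suc) S) (f zero) ⟩
  suc ∣ image (f ∘ suc) S ∣           ≤⟨ s≤s (∣image∣≤ (f ∘ suc) S) ⟩
  suc ∣ S ∣                           ∎
  where
  open ≤-Reasoning
  image⊆ : image f (inside ∷ S) ⊆ image (f ∘ suc) S ∪ ⁅ f zero ⁆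
  image⊆ {w} w∈ with Equivalence.to (∈-image f (inside ∷ S) w) w∈
  ... | zero  , _         , refl = x∈p∪q⁺ (inj₂ (x∈⁅x⁆ (f zero)))
  ... | suc s , there s∈S , eq   =
    x∈p∪q⁺ (inj₁ (Equivalence.from (∈-image (f ∘ suc) S w) (s , s∈S , eq)))

-- The upper bound on images is applied twice, to `f` and to its inverse `g`.
∣image∣≡ : (f : Fin m → Fin n) → Bijective _≡_ _≡_ f → (S : Subset m) → ∣ image f S ∣ ≡ ∣ S ∣
∣image∣≡ f (inj , surj) S = ≤-antisym (∣image∣≤ f S)
  (≤-trans (p⊆q⇒∣p∣≤∣q∣ S⊆image) (∣image∣≤ g (image f S)))
  where
  g = λ w → proj₁ (surj w)

  S⊆image : S ⊆ image g (image f S)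
  S⊆image {v} v∈S = Equivalence.from (∈-image g (image f S) v)
    (f v , Equivalence.from (∈-image f S (f v)) (v , v∈S , refl) , inj (proj₂ (surj (f v)) refl))

-- The X-sets used in the argument

module _ (X : XSetParameter) (G : Graph) where

  open XSetParameter X

  full : XSet X G
  -- The minimum is attained, so some X-set exists, and `⊤` contains it.
  full = ⊤ , [ superset G ⊆⊤ (proj₁ (proj₂ (attained G))) ]

  allBut : Graph.NoIsolatedVertices G → Graph.V G → XSet X G
  allBut noIso v = ∁ ⁅ v ⁆ , [ allButOne G noIso (∁ ⁅ v ⁆) (∣∁⁅x⁆∣≡n∸1 v) ]

  add : XSet X G → Graph.V G → XSet X G
  add (S , [ isX ]) v = S ∪ ⁅ v ⁆ , [ superset G (p⊆p∪q ⁅ v ⁆) isX ]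

-- The bijection induced by a cardinality-preserving isomorphism

module CardinalityPreserving
  (X : XSetParameter) (G G′ : Graph)
  (noIso : Graph.NoIsolatedVertices G) (noIso′ : Graph.NoIsolatedVertices G′)
  (φ : XSet X G → XSet X G′) (iso : IsIsomorphism (TAR X G) (TAR X G′) φ)
  (card : ∀ S → ∣ value (φ S) ∣ ≡ ∣ value S ∣)
  where

  open Graph using (order; V)
  open IsIsomorphism iso

  φ-injective : Injective _≡_ _≡_ φ
  φ-injective = proj₁ bijective

  φ-surjective : StrictlySurjective _≡_ φ
  φ-surjective = surjective⇒strictlySurjective (proj₂ bijective)

  -- The image of `V(G)` has `order G` elements and lies in `V(G′)`; the preimage of `V(G′)` gives
  -- the other inequality.
  orders-equal : order G ≡ order G′
  orders-equal = ≤-antisym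
    (subst (_≤ order G′) (trans (card (full X G)) (∣⊤∣≡n (order G)))
      (∣p∣≤n (value (φ (full X G)))))
    (subst (_≤ order G) ∣S∣≡n′ (∣p∣≤n (value S)))
    where
    S = proj₁ (φ-surjective (full X G′))

    ∣S∣≡n′ : ∣ value S ∣ ≡ order G′
    ∣S∣≡n′ = trans (sym (card S))
      (trans (cong (∣_∣ ∘ value) (proj₂ (φ-surjective (full X G′)))) (∣⊤∣≡n (order G′)))

  -- `S` grows to `T` one vertex at a time. Every intermediate set contains `S`, so it is an X-set,
  -- and every step is an edge; `φ` preserves edges, and `card` orients their images upwards.
  φ-monotone : ∀ S T → value S ⊆ value T → value (φ S) ⊆ value (φ T)
  φ-monotone S T = go S (⊃-wellFounded (value S))
    where
    go : ∀ S → Acc _⊃_ (value S) → value S ⊆ value T → value (φ S) ⊆ value (φ T)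
    go S (acc rec) S⊆T with any? (λ u → (u ∈? value T) ×-dec ¬? (u ∈? value S))
    ... | no ¬∃ = ⊆-reflexive (cong (value ∘ φ) (value-injective {v = S} {w = T}
            (⊆-antisym S⊆T λ {u} u∈T →
              decidable-stable (u ∈? value S) λ u∉S → ¬∃ (u , u∈T , u∉S))))
    ... | yes (u , u∈T , u∉S) = ⊆-trans φS⊆φS∪u (go S∪u (rec S⊂S∪u) S∪u⊆T)
      where
      S∪u = add X G S u

      S⊂S∪u : value S∪u ⊃ value S
      S⊂S∪u = p⊆p∪q ⁅ u ⁆ , u , x∈p∪q⁺ (inj₂ (x∈⁅x⁆ u)) , u∉S

      S∪u⊆T : value S∪u ⊆ value T
      S∪u⊆T x∈ with x∈p∪q⁻ (value S) ⁅ u ⁆ x∈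
      ... | inj₁ x∈S   = S⊆T x∈S
      ... | inj₂ x∈⁅u⁆ = subst (_∈ value T) (sym (x∈⁅y⁆⇒x≡y u x∈⁅u⁆)) u∈T

      φS⊆φS∪u : value (φ S) ⊆ value (φ S∪u)
      φS⊆φS∪u = ∣p⊖q∣≡1∧∣p∣≤∣q∣⇒p⊆q
        (Equivalence.to (adjacency S S∪u) (∣p⊖[p∪⁅x⁆]∣≡1 u∉S))
        (subst₂ _≤_ (sym (card S)) (sym (card S∪u)) (∣p∣≤∣p∪q∣ (value S) ⁅ u ⁆))

  φ-allBut : ∀ v → ∃ λ w → value (φ (allBut X G noIso v)) ≡ ∁ ⁅ w ⁆
  -- The transported `v` serves only to show that `V(G′)` is inhabited; the missing vertex `w` is
  -- found by counting.
  φ-allBut v = ∣p∣≡n∸1⇒p≡∁⁅x⁆ _ (subst Fin orders-equal v)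
    (trans (card (allBut X G noIso v))
      (trans (∣∁⁅x⁆∣≡n∸1 v) (cong (_∸ 1) orders-equal)))

  ψ : V G → V G′
  ψ v = proj₁ (φ-allBut v)

  ψ-injective : Injective _≡_ _≡_ ψ
  ψ-injective {u} {v} ψu≡ψv = ∁⁅⁆-injective (cong value
    (φ-injective {allBut X G noIso u} {allBut X G noIso v} (value-injective
      (trans (proj₂ (φ-allBut u))
        (trans (cong (∁ ∘ ⁅_⁆) ψu≡ψv) (sym (proj₂ (φ-allBut v))))))))

  -- The preimage under `φ` of the coatom missing `w` has the size of a coatom, so it is one, and
  -- the vertex it misses is sent to `w`.
  ψ-surjective : StrictlySurjective _≡_ ψ
  ψ-surjective w =
    let S , φS≡    = φ-surjective (allBut X G′ noIso′ w)
        v , S≡∁⁅v⁆ = ∣p∣≡n∸1⇒p≡∁⁅x⁆ (value S) (subst Fin (sym orders-equal) w)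
          (trans (sym (card S)) (trans (cong (∣_∣ ∘ value) φS≡)
            (trans (∣∁⁅x⁆∣≡n∸1 w) (cong (_∸ 1) (sym orders-equal)))))
    in  v , ∁⁅⁆-injective (trans (sym (proj₂ (φ-allBut v)))
              (trans (cong (value ∘ φ) (sym (value-injective {v = S} S≡∁⁅v⁆))) (cong value φS≡)))

  ψ-bijective : Bijective _≡_ _≡_ ψ
  ψ-bijective = ψ-injective , strictlySurjective⇒surjective ψ-surjective

  ψ-∉ : ∀ S v → v ∉ value S → ψ v ∉ value (φ S)
  ψ-∉ S v v∉S ψv∈φS = x∉∁⁅x⁆ (ψ v) (subst (ψ v ∈_) (proj₂ (φ-allBut v))
    (φ-monotone S (allBut X G noIso v) (x∉p⇒p⊆∁⁅x⁆ v∉S) ψv∈φS))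

  φS⊆image : ∀ S → value (φ S) ⊆ image ψ (value S)
  -- By surjectivity `w` is some `ψ v`, and `v ∉ S` would put `ψ v` outside `φ S`.
  φS⊆image S {w} w∈φS with v , refl ← ψ-surjective w =
    Equivalence.from (∈-image ψ (value S) (ψ v))
      (v , decidable-stable (v ∈? value S) (λ v∉S → ψ-∉ S v v∉S w∈φS) , refl)

  image≡φ : ∀ S → image ψ (value S) ≡ value (φ S)
  image≡φ S = sym (p⊆q∧∣q∣≤∣p∣⇒p≡q (φS⊆image S)
    -- The image has at most `∣ S ∣` elements, which is the size of `φ S`, so the inclusion is an
    -- equality.
    (≤-trans (∣image∣≤ ψ (value S)) (≤-reflexive (sym (card S)))))

theorem2p12 : (X : XSetParameter) (G G′ : Graph) →
    Graph.NoIsolatedVertices G → Graph.NoIsolatedVertices G′ →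
    (φ : XSet X G → XSet X G′) → IsIsomorphism (TAR X G) (TAR X G′) φ →
    (∀ S → ∣ value (φ S) ∣ ≡ ∣ value S ∣) ⇔
    (∃ λ (ψ : Graph.V G → Graph.V G′) →
    Bijective _≡_ _≡_ ψ × (∀ S → image ψ (value S) ≡ value (φ S)))
theorem2p12 X G G′ noIso noIso′ φ iso = mk⇔ forward backward
  where
  forward : (∀ S → ∣ value (φ S) ∣ ≡ ∣ value S ∣) →
            ∃ λ ψ → Bijective _≡_ _≡_ ψ × (∀ S → image ψ (value S) ≡ value (φ S))
  forward card = ψ , ψ-bijective , image≡φ
    where open CardinalityPreserving X G G′ noIso noIso′ φ iso card

  backward : (∃ λ ψ → Bijective _≡_ _≡_ ψ × (∀ S → image ψ (value S) ≡ value (φ S))) →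
             ∀ S → ∣ value (φ S) ∣ ≡ ∣ value S ∣
  backward (ψ , bij , image≡φ) S =
    trans (cong ∣_∣ (sym (image≡φ S))) (∣image∣≡ ψ bij (value S))
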